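{- There is an absolute constant $c>0$ such that for every large enough integer $d$ there exists a $d$-regular bipartite graph $G$, with some number $n$ of vertices on each side, such that every perfect matching in $G$ contains a matching that is induced in $G$ and has size at least $\frac{cn}{\sqrt{d\log d}}$.
   Context: Graphs are finite and simple. A matching $M'$ in $G$ is induced if no two distinct edges of $M'$ are joined by an edge of $G$. -}

module Defs where

open import Data.Fin.Base using (Fin)
open import Data.Fin.Properties using (_<?_)
open import Data.Fin.Subset using (Subset; _∈_; _∉_; ∣_∣; ∁)
open import Data.Fin.Subset.Properties using (_∈?_)
open import Data.Integer.Base as ℤ using ()
open import Data.List.Base using (List; allFin; cartesianProduct; filter; length)
open import Data.Nat.Base using (ℕ; _*_; _^_; _≤_)
open import Data.Product.Base using (_×_; _,_; ∃-syntax)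
open import Data.Rational.Base using (ℚ; ↥_; ↧ₙ_)
open import Data.Sum.Base using (_⊎_)
open import Relation.Binary.PropositionalEquality.Core using (_≡_)
open import Relation.Nullary.Decidable.Core using (_×-dec_)
open import Relation.Nullary.Negation.Core using (¬_)

record Graph (V : ℕ) : Set where
  field
    nbrs       : Fin V → Subset V
    symmetric  : ∀ {u v} → v ∈ nbrs u → u ∈ nbrs v
    loopless   : ∀ {u} → u ∉ nbrs u

  Adj : Fin V → Fin V → Set
  Adj u v = v ∈ nbrs u

  degree : Fin V → ℕ
  degree u = ∣ nbrs u ∣

  -- Each edge occurs exactly once, with its smaller endpoint first.
  edges : List (Fin V × Fin V)
  edges = filter (λ (u , v) → (u <? v) ×-dec (v ∈? nbrs u))
                 (cartesianProduct (allFin V) (allFin V))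

  size : ℕ
  size = length edges

open Graph public

Regular : ∀ {V} → ℕ → Graph V → Set
Regular d G = ∀ u → degree G u ≡ d

record Bipartition {V} (G : Graph V) (n : ℕ) : Set where
  field
    left       : Subset V
    ∣left∣≡n   : ∣ left ∣ ≡ n
    ∣right∣≡n  : ∣ ∁ left ∣ ≡ n
    crossing   : ∀ {u v} → Adj G u v → (u ∈ left × v ∉ left) ⊎ (u ∉ left × v ∈ left)

-- Sets of edges of a graph, in particular matchings, are represented by the
-- spanning subgraphs they form; inclusion of edge sets is then _⊑_.

_⊑_ : ∀ {V} → Graph V → Graph V → Set
H ⊑ G = ∀ {u v} → Adj H u v → Adj G u v

record IsMatching {V} (G M : Graph V) : Set where
  field
    subgraph  : M ⊑ G
    disjoint  : ∀ {u v w} → Adj M u v → Adj M u w → v ≡ w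

record IsPerfectMatching {V} (G M : Graph V) : Set where
  field
    isMatching  : IsMatching G M
    covers      : ∀ u → ∃[ v ] Adj M u v

SameEdge : ∀ {V} → Fin V × Fin V → Fin V × Fin V → Set
SameEdge (u , v) (x , y) = (u ≡ x × v ≡ y) ⊎ (u ≡ y × v ≡ x)

-- An edge may be written with either endpoint first, so forbidding adjacency of
-- the first endpoints u and x forbids it for all four pairs of endpoints.
record IsInducedMatching {V} (G M : Graph V) : Set where
  field
    isMatching  : IsMatching G M
    induced     : ∀ {u v x y} → Adj M u v → Adj M x y →
                  ¬ SameEdge (u , v) (x , y) → ¬ Adj G u x

-- s ≥ c n / √(d log₂ d), for c > 0 and d ≥ 2.  With c = p / q, squaring and
-- clearing denominators gives (p n)² ≤ (q s)² d log₂ d, and exponentiating in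
-- base 2 gives the inequality below.  Another base of the logarithm rescales c
-- by a constant factor.
AtLeast : (c : ℚ) (n d s : ℕ) → Set
AtLeast c n d s = 2 ^ ((ℤ.∣ ↥ c ∣ * n) ^ 2) ≤ d ^ ((↧ₙ c * s) ^ 2 * d)

{-# OPTIONS --safe #-}

-- Let W be a 0/1 matrix with d rows, 2d columns and all row sums d. The bipartite graph whose
-- biadjacency matrix is W stacked on its entrywise complement is d-regular with n = 2d. Take
-- W = (F | J), where F has row sums m and J consists of d - m columns of ones and m columns of
-- zeros. A perfect matching uses at most d - m edges of J, hence at least m edges of F. So it
-- suffices that F, although it has about √(d log d) ones per row, spans only O(m log d)
-- edges between any m rows and any m columns: then the conflict graph of any m matching edges
-- in F has average degree O(log d), and so an independent set of size Ω(m / log d).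
--
-- With L = ⌊log₂ d⌋ and h ≈ √(d / 2L), let m = L h and q = 2 h. Each row of F has exactly one
-- edge into each of m blocks of q columns. The expectation, over uniform independent choices,
-- of the sum of 2^e(R,C) over all pairs of m rows R and m columns C is 2^O(mL); conditional
-- expectations give a choice for which the sum is no larger, so every e(R,C) is O(mL).

module Submission where

open import Algebra.Bundles using (Monoid)
open import Data.Bool.Base using (Bool; true; false; _∧_; not; if_then_else_)
open import Data.Fin.Base as Fin
  using (Fin; zero; suc; _↑ˡ_; _↑ʳ_; combine; remQuot; finToFun; funToFin; splitAt; toℕ)
open import Data.Fin.Properties
  using (_≟_; _<?_; any?; suc-injective; remQuot-combine; finToFun-funToFin; splitAt-↑ˡ; splitAt-↑ʳ;
         splitAt⁻¹-↑ˡ; splitAt⁻¹-↑ʳ; ↑ˡ-injective; toℕ-↑ˡ; toℕ-↑ʳ; toℕ<n; injective⇒≤)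
open import Data.Fin.Subset using (_∈_; ∣_∣)
open import Data.Fin.Subset.Properties using (_∈?_)
import Data.Integer.Base as ℤ
open import Data.List.Base using (lookup)
open import Data.List.Membership.Propositional using () renaming (_∈_ to _∈ᴸ_)
open import Data.List.Membership.Propositional.Properties using (∈-filter⁺; ∈-cartesianProduct⁺; ∈-allFin)
open import Data.List.Relation.Unary.Any using (index)
open import Data.List.Relation.Unary.Any.Properties using (lookup-index)
open import Data.Nat.Base
open import Data.Nat.Properties hiding (_≟_; _<?_; suc-injective)
open import Data.Nat.Solver using (module +-*-Solver)
open import Data.Product.Base using (_×_; _,_; ∃-syntax; Σ-syntax; proj₁; proj₂)
open import Data.Rational.Base as ℚ using (ℚ; Positive)
open import Data.Sum.Base using (_⊎_; inj₁; inj₂; [_,_]′)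
open import Data.Unit.Base using (tt)
open import Data.Vec.Base using (tabulate)
open import Data.Vec.Properties using (lookup∘tabulate; []=⇒lookup; lookup⇒[]=; tabulate-∘)
open import Function.Base using (_∘_; const)
open import Function.Definitions using (Injective)
open import Relation.Binary.PropositionalEquality
open import Relation.Nullary using (¬_; Dec; does; yes; no; contradiction)
open import Relation.Nullary.Decidable using (dec-true; dec-false; _×-dec_; _⊎-dec_)
open import Relation.Unary using (Decidable)

open import Algebra.Properties.Semiring.Sum +-*-semiring
  using (sum; ∑-comm; ∑-distrib-+; *-distribˡ-sum; *-distribʳ-sum; sum-cong-≗)
open import Algebra.Properties.CommutativeMonoid.Sum *-1-commutativeMonoid
  using () renaming (sum to product; sum-cong-≗ to product-cong)
open +-*-Solver using (solve; _:=_; _:+_; _:*_; con)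

open import Defs

-- Finite sums and products

-- Stated over a monoid so that sums and products over `Fin (a * b)` split into nested ones by the
-- same argument.
module _ {c ℓ} (M : Monoid c ℓ) where
  open Monoid M renaming (refl to ≈-refl; sym to ≈-sym; trans to ≈-trans)
  open import Algebra.Properties.Monoid.Sum M using () renaming (sum to fold)

  fold-++ : ∀ a {b} (f : Fin (a + b) → Carrier) →
            fold f ≈ fold (f ∘ (_↑ˡ b)) ∙ fold (f ∘ (a ↑ʳ_))
  fold-++ zero    f = ≈-sym (identityˡ _)
  fold-++ (suc a) f = ≈-trans (∙-congˡ (fold-++ a (f ∘ suc))) (≈-sym (assoc _ _ _))

  fold-combine : ∀ a {b} (f : Fin (a * b) → Carrier) →
                 fold f ≈ fold {a} (λ i → fold {b} (λ j → f (combine i j)))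
  fold-combine zero        f = ≈-refl
  fold-combine (suc a) {b} f =
    ≈-trans (fold-++ b f) (∙-congˡ (fold-combine a (f ∘ (b ↑ʳ_))))

sum-++ : ∀ a {b} (f : Fin (a + b) → ℕ) → sum f ≡ sum (f ∘ (_↑ˡ b)) + sum (f ∘ (a ↑ʳ_))
sum-++ = fold-++ +-0-monoid

sum-combine : ∀ a {b} (f : Fin (a * b) → ℕ) → sum f ≡ sum {a} (λ i → sum {b} (λ j → f (combine i j)))
sum-combine = fold-combine +-0-monoid

product-combine : ∀ a {b} (f : Fin (a * b) → ℕ) →
                  product f ≡ product {a} (λ i → product {b} (λ j → f (combine i j)))
product-combine = fold-combine *-1-monoid

sum-mono : ∀ {n} {f g : Fin n → ℕ} → (∀ i → f i ≤ g i) → sum f ≤ sum g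
sum-mono {zero}  f≤g = z≤n
sum-mono {suc n} f≤g = +-mono-≤ (f≤g zero) (sum-mono (f≤g ∘ suc))

product-mono : ∀ {n} {f g : Fin n → ℕ} → (∀ i → f i ≤ g i) → product f ≤ product g
product-mono {zero}  f≤g = ≤-refl
product-mono {suc n} f≤g = *-mono-≤ (f≤g zero) (product-mono (f≤g ∘ suc))

sum-const : ∀ n x → sum {n} (λ _ → x) ≡ n * x
sum-const zero    x = refl
sum-const (suc n) x = cong (x +_) (sum-const n x)

product-const : ∀ n x → product {n} (λ _ → x) ≡ x ^ n
product-const zero    x = refl
product-const (suc n) x = cong (x *_) (product-const n x)

term≤sum : ∀ {n} (f : Fin n → ℕ) i → f i ≤ sum f
term≤sum f zero    = m≤m+n _ _
term≤sum f (suc i) = ≤-trans (term≤sum (f ∘ suc) i) (m≤n+m _ _)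

product-2^ : ∀ {n} (f : Fin n → ℕ) → product (λ i → 2 ^ f i) ≡ 2 ^ sum f
product-2^ {zero}  f = refl
product-2^ {suc n} f = trans (cong (2 ^ f zero *_) (product-2^ (f ∘ suc)))
                             (sym (^-distribˡ-+-* 2 (f zero) _))

-- Indicators and images of maps

𝟙 : Bool → ℕ
𝟙 true  = 1
𝟙 false = 0

𝟙-mono : ∀ {b c} → (b ≡ true → c ≡ true) → 𝟙 b ≤ 𝟙 c
𝟙-mono {false}       _ = z≤n
𝟙-mono {true}  {c} b⇒c rewrite b⇒c refl = ≤-refl

𝟙≤1 : ∀ b → 𝟙 b ≤ 1
𝟙≤1 false = z≤n
𝟙≤1 true  = ≤-refl

does-true : ∀ {a} {A : Set a} (A? : Dec A) → does A? ≡ true → A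
does-true (yes a) _ = a

sum-select : ∀ {n} (j : Fin n) (h : Fin n → ℕ) → sum (λ i → 𝟙 (does (j ≟ i)) * h i) ≡ h j
sum-select {suc n} zero    h =
  trans (cong₂ _+_ (*-identityˡ (h zero)) (trans (sum-const n 0) (*-zeroʳ n))) (+-identityʳ _)
sum-select {suc n} (suc j) h = sum-select j (h ∘ suc)

sum-≟ : ∀ {n} (j : Fin n) → sum (λ i → 𝟙 (does (j ≟ i))) ≡ 1
sum-≟ j = trans (sum-cong-≗ (λ i → sym (*-identityʳ (𝟙 (does (j ≟ i)))))) (sum-select j (λ _ → 1))

image : ∀ {k n} → (Fin k → Fin n) → Fin n → Bool
image r i = does (any? (λ s → r s ≟ i))

∣image∣≤ : ∀ {k n} (r : Fin k → Fin n) → sum (𝟙 ∘ image r) ≤ k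
∣image∣≤ {k} {n} r = begin
  sum (𝟙 ∘ image r)                                 ≤⟨ sum-mono attained ⟩
  sum {n} (λ i → sum {k} (λ s → 𝟙 (does (r s ≟ i))))  ≡⟨ ∑-comm {n} {k} _ ⟩
  sum {k} (λ s → sum {n} (λ i → 𝟙 (does (r s ≟ i))))  ≡⟨ sum-cong-≗ (λ s → sum-≟ (r s)) ⟩
  sum {k} (λ _ → 1)                                 ≡⟨ sum-const k 1 ⟩
  k * 1                                             ≡⟨ *-identityʳ k ⟩
  k                                                 ∎
  where
  open ≤-Reasoning
  attained : ∀ i → 𝟙 (image r i) ≤ sum (λ s → 𝟙 (does (r s ≟ i)))
  attained i with any? (λ s → r s ≟ i)
  ... | no _          = z≤n
  ... | yes (s , eq)  = ≤-trans (≤-reflexive (cong 𝟙 (sym (dec-true (r s ≟ i) eq))))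
                                (term≤sum (λ s → 𝟙 (does (r s ≟ i))) s)


fibre≤image : ∀ {k n} (r : Fin k → Fin n) → Injective _≡_ _≡_ r → ∀ i →
              sum (λ s → 𝟙 (does (r s ≟ i))) ≤ 𝟙 (image r i)
fibre≤image {k} r inj i with any? (λ s → r s ≟ i)
... | yes (s₀ , eq) = ≤-trans
        (sum-mono (λ s → 𝟙-mono (λ p → dec-true (s₀ ≟ s) (inj (trans eq (sym (does-true (r s ≟ i) p)))))))
        (≤-reflexive (sum-≟ s₀))
... | no ∄s = ≤-reflexive (trans
        (sum-cong-≗ (λ s → cong 𝟙 (dec-false (r s ≟ i) (λ eq → ∄s (s , eq)))))
        (trans (sum-const k 0) (*-zeroʳ k)))

-- Each fibre of an injective `r` has at most one element (`fibre≤image`), so interchanging two sums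
-- suffices. This moves a sum over a chosen tuple to a weighted sum over the whole index set.
sum-injective : ∀ {k n} (r : Fin k → Fin n) → Injective _≡_ _≡_ r → (h : Fin n → ℕ) →
                sum (h ∘ r) ≤ sum (λ i → 𝟙 (image r i) * h i)
sum-injective {k} {n} r inj h = begin
  sum (h ∘ r)                                                  ≡⟨ sum-cong-≗ (λ s → sum-select (r s) h) ⟨
  sum {k} (λ s → sum {n} (λ i → 𝟙 (does (r s ≟ i)) * h i))     ≡⟨ ∑-comm {k} {n} _ ⟩
  sum {n} (λ i → sum {k} (λ s → 𝟙 (does (r s ≟ i)) * h i))     ≡⟨ sum-cong-≗ (λ i → *-distribʳ-sum {k} (h i) _) ⟨
  sum {n} (λ i → sum {k} (λ s → 𝟙 (does (r s ≟ i))) * h i)     ≤⟨ sum-mono (λ i → *-monoˡ-≤ (h i) (fibre≤image r inj i)) ⟩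
  sum (λ i → 𝟙 (image r i) * h i)                              ∎
  where open ≤-Reasoning

-- Averaging and derandomisation

minimum≤average : ∀ q .{{_ : NonZero q}} (h : Fin q → ℕ) → ∃[ x ] q * h x ≤ sum h
minimum≤average (suc zero)    h = zero , ≤-refl
minimum≤average (suc (suc q)) h with minimum≤average (suc q) (h ∘ suc)
... | x , x≤ with h zero ≤? h (suc x)
...   | yes 0≤x = zero  , +-monoʳ-≤ (h zero) (≤-trans (*-monoʳ-≤ (suc q) 0≤x) x≤)
...   | no  0≰x = suc x , +-mono-≤ (≰⇒≥ 0≰x) x≤

-- The method of conditional expectations: the values of f are fixed one after the
-- other, none of them increasing the average of the weighted sum over the rest.
derandomise : ∀ K {N q} .{{_ : NonZero q}} (w : Fin N → ℕ) (g : Fin N → Fin K → Fin q → ℕ) →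
  Σ[ f ∈ (Fin K → Fin q) ]
    q ^ K * sum (λ c → w c * product (λ k → g c k (f k)))
      ≤ sum (λ c → w c * product (λ k → sum (g c k)))
derandomise zero    w g = (λ ()) , ≤-reflexive (+-identityʳ _)
derandomise (suc K) {N} {q} w g = f , bound
  where
  G : Fin N → ℕ
  G c = product (λ k → sum (g c (suc k)))
  h : Fin q → ℕ
  h x = sum (λ c → w c * g c zero x * G c)
  x₀ = proj₁ (minimum≤average q h)
  -- The weights absorb the factor of the coordinate just fixed, so the induction hypothesis applies
  -- to the others.
  rest = derandomise K (λ c → w c * g c zero x₀) (λ c k → g c (suc k))
  f : Fin (suc K) → Fin q
  f zero    = x₀
  f (suc k) = proj₁ rest k
  open ≤-Reasoning
  bound = begin
    q * q ^ K * sum (λ c → w c * (g c zero x₀ * product (λ k → g c (suc k) (f (suc k)))))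
      ≡⟨ *-assoc q (q ^ K) _ ⟩
    q * (q ^ K * sum (λ c → w c * (g c zero x₀ * product (λ k → g c (suc k) (f (suc k))))))
      ≡⟨ cong (λ s → q * (q ^ K * s)) (sum-cong-≗ (λ c → sym (*-assoc (w c) _ _))) ⟩
    q * (q ^ K * sum (λ c → w c * g c zero x₀ * product (λ k → g c (suc k) (f (suc k)))))
      ≤⟨ *-monoʳ-≤ q (proj₂ rest) ⟩
    q * h x₀
      ≤⟨ proj₂ (minimum≤average q h) ⟩
    sum h
      ≡⟨ ∑-comm {q} {N} _ ⟩
    sum (λ c → sum (λ x → w c * g c zero x * G c))
      ≡⟨ sum-cong-≗ (λ c → sym (*-distribʳ-sum {q} (G c) _)) ⟩
    sum (λ c → sum (λ x → w c * g c zero x) * G c)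
      ≡⟨ sum-cong-≗ (λ c → cong (_* G c) (sym (*-distribˡ-sum (w c) (g c zero)))) ⟩
    sum (λ c → w c * sum (g c zero) * G c)
      ≡⟨ sum-cong-≗ (λ c → *-assoc (w c) _ _) ⟩
    sum (λ c → w c * (sum (g c zero) * G c)) ∎

-- A bipartite graph in which small sets of vertices span few edges

^-distribʳ-* : ∀ m n o → (m * n) ^ o ≡ m ^ o * n ^ o
^-distribʳ-* m n zero    = refl
^-distribʳ-* m n (suc o) = trans (cong (m * n *_) (^-distribʳ-* m n o))
  (solve 4 (λ a b c d → a :* b :* (c :* d) := a :* c :* (b :* d)) refl m n (m ^ o) (n ^ o))

2^-cancel-≤ : ∀ {a b} → 2 ^ a ≤ 2 ^ b → a ≤ b
2^-cancel-≤ {a} {b} 2^a≤2^b with a ≤? b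
... | yes a≤b = a≤b
... | no  a≰b = contradiction 2^a≤2^b (<⇒≱ (^-monoʳ-< 2 ≤-refl (≰⇒> a≰b)))

-- Bernoulli's inequality `(1 - 1/(x+1))^h ≥ 1 - h/(x+1)`, with `r` for `x + 1 - h` and denominators
-- cleared. The induction trades one unit of `h` for one of `r`, which rests on `r ≤ x`.
bernoulli : ∀ h r x → suc x ≡ h + r → suc x ^ h * r ≤ suc x * x ^ h
bernoulli zero    r x eq = ≤-reflexive (trans (*-identityˡ r) (trans (sym eq) (sym (*-identityʳ (suc x)))))
bernoulli (suc h) r x eq = begin
  suc x * suc x ^ h * r        ≡⟨ solve 3 (λ a b c → a :* b :* c := b :* (a :* c)) refl (suc x) (suc x ^ h) r ⟩
  suc x ^ h * (suc x * r)      ≤⟨ *-monoʳ-≤ (suc x ^ h) step ⟩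
  suc x ^ h * (x * suc r)      ≡⟨ solve 3 (λ a b c → a :* (b :* c) := b :* (a :* c)) refl (suc x ^ h) x (suc r) ⟩
  x * (suc x ^ h * suc r)      ≤⟨ *-monoʳ-≤ x (bernoulli h (suc r) x (trans eq (sym (+-suc h r)))) ⟩
  x * (suc x * x ^ h)          ≡⟨ solve 3 (λ a b c → a :* (b :* c) := b :* (a :* c)) refl x (suc x) (x ^ h) ⟩
  suc x * (x * x ^ h)          ∎
  where
  open ≤-Reasoning
  r≤x : r ≤ x
  r≤x = subst (r ≤_) (sym (cong pred eq)) (m≤n+m r h)
  step : suc x * r ≤ x * suc r
  step = subst (suc x * r ≤_) (sym (*-suc x r)) (+-monoˡ-≤ (x * r) r≤x)

-- For `r = x + 1 - h` the hypothesis gives `x + 1 ≤ 2 * r`, so Bernoulli's inequality loses only a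
-- factor 2.
suc^≤2*^ : ∀ h x → 2 * h ≤ x → suc x ^ h ≤ 2 * x ^ h
suc^≤2*^ h x 2h≤x = *-cancelˡ-≤ (suc x) (begin
  suc x * suc x ^ h    ≡⟨ *-comm (suc x) _ ⟩
  suc x ^ h * suc x    ≤⟨ *-monoʳ-≤ (suc x ^ h) x<2r ⟩
  suc x ^ h * (2 * r)  ≡⟨ solve 2 (λ a b → a :* (con 2 :* b) := con 2 :* (a :* b)) refl (suc x ^ h) r ⟩
  2 * (suc x ^ h * r)  ≤⟨ *-monoʳ-≤ 2 (bernoulli h r x x≡) ⟩
  2 * (suc x * x ^ h)  ≡⟨ solve 2 (λ a b → con 2 :* (a :* b) := a :* (con 2 :* b)) refl (suc x) (x ^ h) ⟩
  suc x * (2 * x ^ h)  ∎)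
  where
  open ≤-Reasoning
  r = suc x ∸ h
  x≡ : suc x ≡ h + r
  x≡ = sym (m+[n∸m]≡n (m≤n⇒m≤1+n (≤-trans (m≤n*m h 2) 2h≤x)))
  x<2r : suc x ≤ 2 * r
  x<2r = +-cancelˡ-≤ (2 * h) _ _ (begin
    2 * h + suc x   ≤⟨ +-monoˡ-≤ (suc x) (m≤n⇒m≤1+n 2h≤x) ⟩
    suc x + suc x   ≡⟨ cong (suc x +_) (+-identityʳ (suc x)) ⟨
    2 * suc x       ≡⟨ cong (2 *_) x≡ ⟩
    2 * (h + r)     ≡⟨ *-distribˡ-+ 2 h r ⟩
    2 * h + 2 * r   ∎)

-- Every unit added to a base of at least `2 * h` at most doubles the `h`-th power. This is why
-- blocks have `2 * h` columns.
+^≤^*2^ : ∀ h β → (2 * h + β) ^ h ≤ (2 * h) ^ h * 2 ^ β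
+^≤^*2^ h zero    = ≤-reflexive (trans (cong (_^ h) (+-identityʳ (2 * h))) (sym (*-identityʳ _)))
+^≤^*2^ h (suc β) = begin
  (2 * h + suc β) ^ h            ≡⟨ cong (_^ h) (+-suc (2 * h) β) ⟩
  suc (2 * h + β) ^ h            ≤⟨ suc^≤2*^ h (2 * h + β) (m≤m+n (2 * h) β) ⟩
  2 * (2 * h + β) ^ h            ≤⟨ *-monoʳ-≤ 2 (+^≤^*2^ h β) ⟩
  2 * ((2 * h) ^ h * 2 ^ β)      ≡⟨ solve 2 (λ a b → con 2 :* (a :* b) := a :* (con 2 :* b)) refl ((2 * h) ^ h) (2 ^ β) ⟩
  (2 * h) ^ h * (2 * 2 ^ β)      ∎
  where open ≤-Reasoning

-- The blockwise estimates multiply to a bound that depends on the `β j` only through their sum,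
-- however a column set is spread over the blocks.
product-+^≤ : ∀ h {m} (β : Fin m → ℕ) →
              product (λ j → 2 * h + β j) ^ h ≤ ((2 * h) ^ m) ^ h * 2 ^ sum β
product-+^≤ h {zero}  β = m≤m*n (1 ^ h) 1
product-+^≤ h {suc m} β = begin
  ((2 * h + β zero) * product (λ j → 2 * h + β (suc j))) ^ h
    ≡⟨ ^-distribʳ-* (2 * h + β zero) _ h ⟩
  (2 * h + β zero) ^ h * product (λ j → 2 * h + β (suc j)) ^ h
    ≤⟨ *-mono-≤ (+^≤^*2^ h (β zero)) (product-+^≤ h (β ∘ suc)) ⟩
  (2 * h) ^ h * 2 ^ β zero * (((2 * h) ^ m) ^ h * 2 ^ sum (β ∘ suc))
    ≡⟨ solve 4 (λ a b c d → a :* b :* (c :* d) := a :* c :* (b :* d)) refl ((2 * h) ^ h) (2 ^ β zero) _ _ ⟩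
  (2 * h) ^ h * ((2 * h) ^ m) ^ h * (2 ^ β zero * 2 ^ sum (β ∘ suc))
    ≡⟨ cong₂ _*_ (sym (^-distribʳ-* (2 * h) ((2 * h) ^ m) h)) (sym (^-distribˡ-+-* 2 (β zero) _)) ⟩
  ((2 * h) * (2 * h) ^ m) ^ h * 2 ^ (β zero + sum (β ∘ suc)) ∎
  where open ≤-Reasoning

-- With `k` true values the product is `P^k Q^(n-k)`; the extra power of `Q` on the left avoids the
-- subtraction.
product-if : ∀ {n} (b : Fin n → Bool) P Q →
  product (λ i → if b i then P else Q) * Q ^ sum (𝟙 ∘ b) ≡ P ^ sum (𝟙 ∘ b) * Q ^ n
product-if {zero}  b P Q = refl
product-if {suc n} b P Q with b zero
... | true  = trans (solve 4 (λ p x q y → p :* x :* (q :* y) := p :* q :* (x :* y)) refl P X Q Y)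
                (trans (cong (P * Q *_) (product-if (b ∘ suc) P Q))
                  (solve 4 (λ p q x y → p :* q :* (x :* y) := p :* x :* (q :* y)) refl P Q _ (Q ^ n)))
  where
  X = product (λ i → if b (suc i) then P else Q)
  Y = Q ^ sum (𝟙 ∘ b ∘ suc)
... | false = trans (*-assoc Q _ _) (trans (cong (Q *_) (product-if (b ∘ suc) P Q))
                (solve 3 (λ q x y → q :* (x :* y) := x :* (q :* y)) refl Q (P ^ sum (𝟙 ∘ b ∘ suc)) (Q ^ n)))

product-if-≤ : ∀ {n} (b : Fin n → Bool) {m P Q} .{{_ : NonZero Q}} → Q ≤ P → sum (𝟙 ∘ b) ≤ m →
  product (λ i → if b i then P else Q) * Q ^ m ≤ P ^ m * Q ^ n
product-if-≤ {n} b {m} {P} {Q} Q≤P #b≤m = begin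
  X * Q ^ m                  ≡⟨ cong (λ e → X * Q ^ e) (sym (m+[n∸m]≡n #b≤m)) ⟩
  X * Q ^ (k + (m ∸ k))      ≡⟨ cong (X *_) (^-distribˡ-+-* Q k _) ⟩
  X * (Q ^ k * Q ^ (m ∸ k))  ≡⟨ *-assoc X _ _ ⟨
  X * Q ^ k * Q ^ (m ∸ k)    ≡⟨ cong (_* Q ^ (m ∸ k)) (product-if b P Q) ⟩
  P ^ k * Q ^ n * Q ^ (m ∸ k)   ≤⟨ *-monoʳ-≤ (P ^ k * Q ^ n) (^-monoˡ-≤ (m ∸ k) Q≤P) ⟩
  P ^ k * Q ^ n * P ^ (m ∸ k)   ≡⟨ solve 3 (λ a b c → a :* b :* c := a :* c :* b) refl (P ^ k) (Q ^ n) _ ⟩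
  P ^ k * P ^ (m ∸ k) * Q ^ n   ≡⟨ cong (_* Q ^ n) (^-distribˡ-+-* P k _) ⟨
  P ^ (k + (m ∸ k)) * Q ^ n     ≡⟨ cong (λ e → P ^ e * Q ^ n) (m+[n∸m]≡n #b≤m) ⟩
  P ^ m * Q ^ n              ∎
  where
  open ≤-Reasoning
  X = product (λ i → if b i then P else Q)
  k = sum (𝟙 ∘ b)

-- blockGraph f is the bipartite graph in which every row i has, for each j, exactly one
-- neighbour in the j-th block of q consecutive columns, namely number f i j of the block.
blockGraph : ∀ {d m q} → (Fin d → Fin m → Fin q) → Fin d → Fin (m * q) → Bool
blockGraph {m = m} {q} f i y = does (f i (proj₁ (remQuot {m} q y)) ≟ proj₂ (remQuot {m} q y))

blockGraph-combine : ∀ {d m q} (f : Fin d → Fin m → Fin q) i j x → blockGraph f i (combine j x) ≡ does (f i j ≟ x)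
blockGraph-combine f i j x = cong (λ p → does (f i (proj₁ p) ≟ proj₂ p)) (remQuot-combine j x)

-- Derandomised choice of the block graph

module Sparse (L h d : ℕ) .{{_ : NonZero h}} where
  m = L * h
  q = 2 * h

  instance
    q≢0 : NonZero q
    q≢0 = m*n≢0 2 h

  hit : (Fin m → Fin d) → (Fin m → Fin (m * q)) → Fin d → Fin m → Fin q → Bool
  hit r c i j x = image r i ∧ image c (combine j x)

  -- A row has one neighbour per block, so the sum over the columns of block `j` collapses to the
  -- term at `f i j`. Two to the power of the result is a product with one factor per free choice,
  -- the form that `derandomise` takes.
  edges≤hits : ∀ f r c → Injective _≡_ _≡_ r → Injective _≡_ _≡_ c →
    sum {m} (λ s → sum {m} (λ t → 𝟙 (blockGraph f (r s) (c t)))) ≤ sum (λ i → sum (λ j → 𝟙 (hit r c i j (f i j))))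
  edges≤hits f r c r-inj c-inj = begin
    sum {m} (λ s → sum {m} (λ t → 𝟙 (blockGraph f (r s) (c t))))
      ≤⟨ sum-mono (λ s → sum-injective c c-inj (λ y → 𝟙 (blockGraph f (r s) y))) ⟩
    sum (λ s → E (r s))
      ≤⟨ sum-injective r r-inj E ⟩
    sum (λ i → 𝟙 (image r i) * E i)
      ≡⟨ sum-cong-≗ (λ i → cong (𝟙 (image r i) *_) (row i)) ⟩
    sum (λ i → 𝟙 (image r i) * sum (λ j → 𝟙 (image c (combine j (f i j)))))
      ≡⟨ sum-cong-≗ (λ i → *-distribˡ-sum {m} (𝟙 (image r i)) _) ⟩
    sum (λ i → sum (λ j → 𝟙 (image r i) * 𝟙 (image c (combine j (f i j)))))
      ≡⟨ sum-cong-≗ (λ i → sum-cong-≗ {m} (λ j → 𝟙-∧ (image r i) _)) ⟩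
    sum (λ i → sum (λ j → 𝟙 (hit r c i j (f i j)))) ∎
    where
    open ≤-Reasoning
    E : Fin d → ℕ
    E i = sum (λ y → 𝟙 (image c y) * 𝟙 (blockGraph f i y))
    𝟙-∧ : ∀ a b → 𝟙 a * 𝟙 b ≡ 𝟙 (a ∧ b)
    𝟙-∧ true  b = *-identityˡ (𝟙 b)
    𝟙-∧ false b = refl
    row : ∀ i → E i ≡ sum (λ j → 𝟙 (image c (combine j (f i j))))
    row i = trans (sum-combine m _) (sum-cong-≗ {m} (λ j →
      trans (sum-cong-≗ {q} (λ x → trans (cong (λ b → 𝟙 (image c (combine j x)) * 𝟙 b) (blockGraph-combine f i j x))
                                     (*-comm (𝟙 (image c (combine j x))) _)))
            (sum-select (f i j) (λ x → 𝟙 (image c (combine j x))))))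

  -- Since m = L h, the m-th power of a row factor P is the L-th power of P ^ h, and q = 2 h makes
  -- (q + β) ^ h ≤ q ^ h * 2 ^ β.
  hits-average : ∀ r c → product (λ i → product (λ j → sum (λ x → 2 ^ 𝟙 (hit r c i j x)))) ≤ (q ^ m) ^ d * 2 ^ (m * L)
  hits-average r c = *-cancelʳ-≤ _ _ (Q ^ m) {{m^n≢0 Q m}} (begin
    product (λ i → product (λ j → sum (λ x → 2 ^ 𝟙 (hit r c i j x)))) * Q ^ m
      ≤⟨ *-monoˡ-≤ (Q ^ m) (product-mono row≤) ⟩
    product (λ i → if image r i then P else Q) * Q ^ m
      ≤⟨ product-if-≤ (image r) Q≤P (∣image∣≤ r) ⟩
    P ^ m * Q ^ d
      ≤⟨ *-monoˡ-≤ (Q ^ d) P^m≤ ⟩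
    Q ^ m * 2 ^ (m * L) * Q ^ d
      ≡⟨ solve 3 (λ a b c → a :* b :* c := c :* b :* a) refl (Q ^ m) (2 ^ (m * L)) (Q ^ d) ⟩
    Q ^ d * 2 ^ (m * L) * Q ^ m ∎)
    where
    open ≤-Reasoning
    β : Fin m → ℕ
    β j = sum (λ x → 𝟙 (image c (combine j x)))
    P = product (λ j → q + β j)
    Q = q ^ m
    instance
      Q≢0 : NonZero Q
      Q≢0 = m^n≢0 q m
    Q≤P : Q ≤ P
    Q≤P = ≤-trans (≤-reflexive (sym (product-const m q))) (product-mono (λ j → m≤m+n q (β j)))
    2^𝟙 : ∀ b → 2 ^ 𝟙 b ≡ 1 + 𝟙 b
    2^𝟙 true  = refl
    2^𝟙 false = refl
    q≡ : sum {q} (λ _ → 1) ≡ q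
    q≡ = trans (sum-const q 1) (*-identityʳ q)
    -- In a chosen row, `2 ^ 𝟙 b ≡ 1 + 𝟙 b` makes the sum over block `j` equal to `q + β j`; in any
    -- other row all `q` terms are 1.
    row≤ : ∀ i → product (λ j → sum (λ x → 2 ^ 𝟙 (hit r c i j x))) ≤ (if image r i then P else Q)
    row≤ i with image r i
    ... | true  = product-mono {m} (λ j → ≤-reflexive
                    (trans (sum-cong-≗ (λ x → 2^𝟙 (image c (combine j x))))
                      (trans (∑-distrib-+ (λ _ → 1) (λ x → 𝟙 (image c (combine j x)))) (cong (_+ β j) q≡))))
    ... | false = ≤-reflexive (trans (product-cong {m} (λ j → q≡)) (product-const m q))
    ∑β≤m : sum β ≤ m
    ∑β≤m = ≤-trans (≤-reflexive (sym (sum-combine m (𝟙 ∘ image c)))) (∣image∣≤ c)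
    P^m≤ : P ^ m ≤ Q ^ m * 2 ^ (m * L)
    P^m≤ = begin
      P ^ (L * h)               ≡⟨ cong (P ^_) (*-comm L h) ⟩
      P ^ (h * L)               ≡⟨ ^-*-assoc P h L ⟨
      (P ^ h) ^ L               ≤⟨ ^-monoˡ-≤ L (≤-trans (product-+^≤ h β) (*-monoʳ-≤ (Q ^ h) (^-monoʳ-≤ 2 ∑β≤m))) ⟩
      (Q ^ h * 2 ^ m) ^ L       ≡⟨ ^-distribʳ-* (Q ^ h) (2 ^ m) L ⟩
      (Q ^ h) ^ L * (2 ^ m) ^ L ≡⟨ cong₂ _*_ (trans (^-*-assoc Q h L) (cong (Q ^_) (*-comm h L))) (^-*-assoc 2 m L) ⟩
      Q ^ (L * h) * 2 ^ (m * L) ∎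

  -- A first moment bound over all pairs of tuples, injective or not: there are at most
  -- `2^(2(L+1)m)` of them, and `2 ^ hits` averages at most `2^(mL)` for each. The chosen `f` keeps
  -- the total at or below its average, and the total bounds every single term.
  sparse : m * q ≤ d → d ≤ 2 ^ suc L →
    Σ[ f ∈ (Fin d → Fin m → Fin q) ] (∀ r c → Injective _≡_ _≡_ r → Injective _≡_ _≡_ c →
      sum {m} (λ s → sum {m} (λ t → 𝟙 (blockGraph f (r s) (c t)))) ≤ m * (3 * L + 2))
  sparse mq≤d d≤2^ = f , bound
    where
    N₁ = d ^ m
    N₂ = (m * q) ^ m
    N = N₁ * N₂
    rowsOf : Fin N → Fin m → Fin d
    rowsOf c = finToFun (proj₁ (remQuot {N₁} N₂ c))
    colsOf : Fin N → Fin m → Fin (m * q)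
    colsOf c = finToFun (proj₂ (remQuot {N₁} N₂ c))
    g : Fin N → Fin (d * m) → Fin q → ℕ
    g c k x = 2 ^ 𝟙 (hit (rowsOf c) (colsOf c) (proj₁ (remQuot {d} m k)) (proj₂ (remQuot {d} m k)) x)
    choice = derandomise (d * m) (λ _ → 1) g
    f : Fin d → Fin m → Fin q
    f i j = proj₁ choice (combine i j)
    hits : Fin N → ℕ
    hits c = sum (λ i → sum (λ j → 𝟙 (hit (rowsOf c) (colsOf c) i j (f i j))))
    g-combine : ∀ c i j x → g c (combine i j) x ≡ 2 ^ 𝟙 (hit (rowsOf c) (colsOf c) i j x)
    g-combine c i j x = cong (λ p → 2 ^ 𝟙 (hit (rowsOf c) (colsOf c) (proj₁ p) (proj₂ p) x)) (remQuot-combine i j)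
    chosen : ∀ c → product (λ k → g c k (proj₁ choice k)) ≡ 2 ^ hits c
    chosen c = trans (product-combine d _) (trans
      (product-cong {d} (λ i → trans (product-cong {m} (λ j → g-combine c i j (f i j))) (product-2^ {m} _)))
      (product-2^ {d} _))
    average : ∀ c → 1 * product (λ k → sum (g c k)) ≤ q ^ (d * m) * 2 ^ (m * L)
    average c = begin
      1 * product (λ k → sum (g c k))                          ≡⟨ *-identityˡ _ ⟩
      product (λ k → sum (g c k))                              ≡⟨ product-combine d _ ⟩
      product {d} (λ i → product {m} (λ j → sum (g c (combine i j))))
        ≡⟨ product-cong {d} (λ i → product-cong {m} (λ j → sum-cong-≗ {q} (g-combine c i j))) ⟩
      product {d} (λ i → product {m} (λ j → sum (λ x → 2 ^ 𝟙 (hit (rowsOf c) (colsOf c) i j x))))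
        ≤⟨ hits-average (rowsOf c) (colsOf c) ⟩
      (q ^ m) ^ d * 2 ^ (m * L)    ≡⟨ cong (_* 2 ^ (m * L)) (trans (^-*-assoc q m d) (cong (q ^_) (*-comm m d))) ⟩
      q ^ (d * m) * 2 ^ (m * L)    ∎
      where open ≤-Reasoning
    N≤ : N ≤ 2 ^ (suc L * m) * 2 ^ (suc L * m)
    N≤ = *-mono-≤ (power d≤2^) (power (≤-trans mq≤d d≤2^))
      where
      power : ∀ {a} → a ≤ 2 ^ suc L → a ^ m ≤ 2 ^ (suc L * m)
      power a≤ = ≤-trans (^-monoˡ-≤ m a≤) (≤-reflexive (^-*-assoc 2 (suc L) m))
    exponent : suc L * m + suc L * m + m * L ≡ m * (3 * L + 2)
    exponent = solve 2 (λ l m → (con 1 :+ l) :* m :+ (con 1 :+ l) :* m :+ m :* l := m :* (con 3 :* l :+ con 2)) refl L m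
    open ≤-Reasoning
    hits≤ : ∀ c → hits c ≤ m * (3 * L + 2)
    hits≤ c = 2^-cancel-≤ (begin
      2 ^ hits c                                     ≡⟨ trans (*-identityˡ _) (chosen c) ⟨
      1 * product (λ k → g c k (proj₁ choice k))     ≤⟨ term≤sum (λ c → 1 * product (λ k → g c k (proj₁ choice k))) c ⟩
      S                                              ≤⟨ *-cancelˡ-≤ (q ^ (d * m)) {{m^n≢0 q (d * m)}} total ⟩
      N * 2 ^ (m * L)                                ≤⟨ *-monoˡ-≤ (2 ^ (m * L)) N≤ ⟩
      2 ^ (suc L * m) * 2 ^ (suc L * m) * 2 ^ (m * L)
        ≡⟨ cong (_* 2 ^ (m * L)) (^-distribˡ-+-* 2 (suc L * m) (suc L * m)) ⟨
      2 ^ (suc L * m + suc L * m) * 2 ^ (m * L)      ≡⟨ ^-distribˡ-+-* 2 (suc L * m + suc L * m) (m * L) ⟨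
      2 ^ (suc L * m + suc L * m + m * L)            ≡⟨ cong (2 ^_) exponent ⟩
      2 ^ (m * (3 * L + 2))                          ∎)
      where
      S = sum (λ c → 1 * product (λ k → g c k (proj₁ choice k)))
      -- `q ^ (d * m)` is the number of choices of `f`, by which the derandomised bound is scaled.
      total : q ^ (d * m) * S ≤ q ^ (d * m) * (N * 2 ^ (m * L))
      total = begin
        q ^ (d * m) * S                                     ≤⟨ proj₂ choice ⟩
        sum (λ c → 1 * product (λ k → sum (g c k)))         ≤⟨ sum-mono average ⟩
        sum {N} (λ c → q ^ (d * m) * 2 ^ (m * L))           ≡⟨ sum-const N _ ⟩
        N * (q ^ (d * m) * 2 ^ (m * L))
          ≡⟨ solve 3 (λ a b c → a :* (b :* c) := b :* (a :* c)) refl N (q ^ (d * m)) (2 ^ (m * L)) ⟩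
        q ^ (d * m) * (N * 2 ^ (m * L))                     ∎
    bound : ∀ r c → Injective _≡_ _≡_ r → Injective _≡_ _≡_ c →
            sum {m} (λ s → sum {m} (λ t → 𝟙 (blockGraph f (r s) (c t)))) ≤ m * (3 * L + 2)
    bound r c r-inj c-inj = begin
      sum {m} (λ s → sum {m} (λ t → 𝟙 (blockGraph f (r s) (c t))))
        ≡⟨ sum-cong-≗ {m} (λ s → sum-cong-≗ {m} (λ t → cong₂ (λ i y → 𝟙 (blockGraph f i y)) (r≗ s) (c≗ t))) ⟨
      sum (λ s → sum (λ t → 𝟙 (blockGraph f (rowsOf e s) (colsOf e t))))
        ≤⟨ edges≤hits f (rowsOf e) (colsOf e)
             (λ p → r-inj (trans (sym (r≗ _)) (trans p (r≗ _))))
             (λ p → c-inj (trans (sym (c≗ _)) (trans p (c≗ _)))) ⟩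
      hits e
        ≤⟨ hits≤ e ⟩
      m * (3 * L + 2) ∎
      where
      e : Fin N
      e = combine (funToFin r) (funToFin c)
      r≗ : ∀ s → rowsOf e s ≡ r s
      r≗ s = trans (cong (λ p → finToFun (proj₁ p) s) (remQuot-combine (funToFin r) (funToFin c)))
                   (finToFun-funToFin r s)
      c≗ : ∀ s → colsOf e s ≡ c s
      c≗ s = trans (cong (λ p → finToFun (proj₂ p) s) (remQuot-combine (funToFin r) (funToFin c)))
                   (finToFun-funToFin c s)

-- Independent sets in sparse conflict graphs

does-false : ∀ {a} {A : Set a} (A? : Dec A) → does A? ≡ false → ¬ A
does-false (no ¬a) _ = ¬a

choose : ∀ {n} (b : Fin n → Bool) m → m ≤ sum (𝟙 ∘ b) →
         Σ[ r ∈ (Fin m → Fin n) ] (Injective _≡_ _≡_ r × (∀ s → b (r s) ≡ true))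
choose b zero _ = (λ ()) , (λ { {()} }) , λ ()
choose {suc n} b (suc m) m≤ with b zero in b₀
... | false = let r , inj , br = choose (b ∘ suc) (suc m) m≤ in
              suc ∘ r , inj ∘ suc-injective , br
... | true  = r′ , inj′ , br′
  where
  rest = choose (b ∘ suc) m (s≤s⁻¹ m≤)
  r′ : Fin (suc m) → Fin (suc n)
  r′ zero    = zero
  r′ (suc s) = suc (proj₁ rest s)
  inj′ : Injective _≡_ _≡_ r′
  inj′ {zero}  {zero}  _ = refl
  inj′ {suc s} {suc t} p = cong suc (proj₁ (proj₂ rest) (suc-injective p))
  br′ : ∀ s → b (r′ s) ≡ true
  br′ zero    = b₀
  br′ (suc s) = proj₂ (proj₂ rest) s

module Independent {n} (K : Fin n → Fin n → Bool) (K-refl : ∀ x → K x x ≡ true) where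

  -- `K` may be asymmetric: later `K s t` says that the row of matching edge `s` is adjacent to the
  -- column of edge `t`. Either direction is a conflict.
  conflicts : Fin n → Fin n → ℕ
  conflicts x y = 𝟙 (K x y) + 𝟙 (K y x)

  deg : Fin n → ℕ
  deg y = sum (λ x → conflicts x y)

  IsIndependent : ∀ {k} → (Fin k → Fin n) → Set
  IsIndependent ι = ∀ s t → K (ι s) (ι t) ≡ true → s ≡ t

  -- The last entry is treated first, and an entry is kept if it conflicts with none kept before.
  -- Reflexivity of `K` lets a kept entry dominate itself.
  maximal : ∀ {l} (xs : Fin l → Fin n) → Σ[ k ∈ ℕ ] Σ[ ι ∈ (Fin k → Fin n) ]
    (IsIndependent ι × (∀ t → ∃[ s ] ι t ≡ xs s) × (∀ s → ∃[ t ] 1 ≤ conflicts (xs s) (ι t)))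
  maximal {zero}  xs = 0 , (λ ()) , (λ ()) , (λ ()) , (λ ())
  maximal {suc l} xs with maximal (xs ∘ suc)
  ... | k , ι , ind , ⊆xs , dom with any? (λ t → 1 ≤? conflicts (xs zero) (ι t))
  ...   | yes (t , 1≤) = k , ι , ind , (λ t → let s , eq = ⊆xs t in suc s , eq) ,
                         λ { zero → t , 1≤ ; (suc s) → dom s }
  ...   | no free = suc k , ι′ , ind′ , ⊆xs′ , dom′
    where
    ι′ : Fin (suc k) → Fin n
    ι′ zero    = xs zero
    ι′ (suc t) = ι t
    ind′ : IsIndependent ι′
    ind′ zero    zero    _ = refl
    ind′ zero    (suc t) p = contradiction
      (t , ≤-trans (≤-reflexive (cong 𝟙 (sym p))) (m≤m+n _ _)) free
    ind′ (suc s) zero    p = contradiction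
      (s , ≤-trans (≤-reflexive (cong 𝟙 (sym p))) (m≤n+m _ (𝟙 (K (xs zero) (ι s))))) free
    ind′ (suc s) (suc t) p = cong suc (ind s t p)
    ⊆xs′ : ∀ t → ∃[ s ] ι′ t ≡ xs s
    ⊆xs′ zero    = zero , refl
    ⊆xs′ (suc t) = let s , eq = ⊆xs t in suc s , eq
    dom′ : ∀ s → ∃[ t ] 1 ≤ conflicts (xs s) (ι′ t)
    dom′ zero    = zero , ≤-trans (≤-reflexive (cong 𝟙 (sym (K-refl (xs zero))))) (m≤m+n _ _)
    dom′ (suc s) = let t , 1≤ = dom s in suc t , 1≤

  -- Each of the `l` vertices conflicts with a kept one, and each kept one accounts for at most `Δ`
  -- conflicts.
  greedy : ∀ Δ {l} (xs : Fin l → Fin n) → Injective _≡_ _≡_ xs → (∀ s → deg (xs s) ≤ Δ) →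
    Σ[ k ∈ ℕ ] Σ[ ι ∈ (Fin k → Fin n) ] (IsIndependent ι × l ≤ k * Δ)
  greedy Δ {l} xs xs-inj low with maximal xs
  ... | k , ι , ind , ⊆xs , dom = k , ι , ind , (begin
    l                                                      ≡⟨ *-identityʳ l ⟨
    l * 1                                                  ≡⟨ sum-const l 1 ⟨
    sum {l} (λ _ → 1)                                      ≤⟨ sum-mono (λ s → let t , 1≤ = dom s in
                                                                ≤-trans 1≤ (term≤sum (λ t → conflicts (xs s) (ι t)) t)) ⟩
    sum {l} (λ s → sum {k} (λ t → conflicts (xs s) (ι t)))   ≡⟨ ∑-comm {l} {k} _ ⟩
    sum {k} (λ t → sum {l} (λ s → conflicts (xs s) (ι t)))   ≤⟨ sum-mono (λ t → sum-injective xs xs-inj (λ x → conflicts x (ι t))) ⟩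
    sum {k} (λ t → sum {n} (λ x → 𝟙 (image xs x) * conflicts x (ι t)))
      ≤⟨ sum-mono {k} (λ t → sum-mono {n} (λ x → *-monoˡ-≤ (conflicts x (ι t)) (𝟙≤1 (image xs x)))) ⟩
    sum {k} (λ t → sum {n} (λ x → 1 * conflicts x (ι t)))
      ≡⟨ sum-cong-≗ {k} (λ t → sum-cong-≗ {n} (λ x → *-identityˡ (conflicts x (ι t)))) ⟩
    sum {k} (λ t → deg (ι t))                              ≤⟨ sum-mono {k} (λ t → let s , eq = ⊆xs t in subst (λ x → deg x ≤ Δ) (sym eq) (low s)) ⟩
    sum {k} (λ _ → Δ)                                      ≡⟨ sum-const k Δ ⟩
    k * Δ                                                  ∎)
    where open ≤-Reasoning

  -- By Markov's inequality at least half of the vertices have at most twice the average degree.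
  turán : ∀ D .{{_ : NonZero D}} → sum (λ x → sum (λ y → 𝟙 (K x y))) ≤ n * D →
    Σ[ k ∈ ℕ ] Σ[ ι ∈ (Fin k → Fin n) ] (IsIndependent ι × n ≤ 2 * (k * (4 * D)))
  turán D few =
    let xs , xs-inj , low-xs = choose low #low ≤-refl
        k , ι , ind , #low≤  = greedy (4 * D) xs xs-inj (λ s → does-true (deg (xs s) ≤? 4 * D) (low-xs s))
    in  k , ι , ind , ≤-trans half (*-monoʳ-≤ 2 #low≤)
    where
    open ≤-Reasoning
    low : Fin n → Bool
    -- `deg` counts both directions, so its average is at most `2 * D` and the threshold is twice
    -- that.
    low y = does (deg y ≤? 4 * D)
    #low = sum (𝟙 ∘ low)
    pointwise : ∀ y → 4 * D ≤ 4 * D * 𝟙 (low y) + deg y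
    pointwise y with low y in low-y
    ... | true  = ≤-trans (≤-reflexive (sym (*-identityʳ (4 * D)))) (m≤m+n _ _)
    ... | false = ≤-trans (≰⇒≥ (does-false (deg y ≤? 4 * D) low-y)) (m≤n+m _ _)
    ∑deg≤ : sum deg ≤ n * D + n * D
    ∑deg≤ = begin
      sum {n} (λ y → sum {n} (λ x → 𝟙 (K x y) + 𝟙 (K y x)))
        ≡⟨ sum-cong-≗ {n} (λ y → ∑-distrib-+ (λ x → 𝟙 (K x y)) (λ x → 𝟙 (K y x))) ⟩
      sum {n} (λ y → sum {n} (λ x → 𝟙 (K x y)) + sum {n} (λ x → 𝟙 (K y x)))
        ≡⟨ ∑-distrib-+ (λ y → sum {n} (λ x → 𝟙 (K x y))) (λ y → sum {n} (λ x → 𝟙 (K y x))) ⟩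
      sum {n} (λ y → sum {n} (λ x → 𝟙 (K x y))) + sum {n} (λ y → sum {n} (λ x → 𝟙 (K y x)))
        ≤⟨ +-mono-≤ (≤-trans (≤-reflexive (∑-comm {n} {n} _)) few) few ⟩
      n * D + n * D ∎
    half : n ≤ 2 * #low
    half = *-cancelʳ-≤ n (2 * #low) (2 * D) {{m*n≢0 2 D}} (+-cancelʳ-≤ (n * D + n * D) _ _ (begin
      n * (2 * D) + (n * D + n * D)   ≡⟨ solve 2 (λ n d → n :* (con 2 :* d) :+ (n :* d :+ n :* d) := n :* (con 4 :* d)) refl n D ⟩
      n * (4 * D)                     ≡⟨ sum-const n (4 * D) ⟨
      sum {n} (λ _ → 4 * D)           ≤⟨ sum-mono pointwise ⟩
      sum {n} (λ y → 4 * D * 𝟙 (low y) + deg y)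
        ≡⟨ ∑-distrib-+ (λ y → 4 * D * 𝟙 (low y)) deg ⟩
      sum {n} (λ y → 4 * D * 𝟙 (low y)) + sum deg
        ≡⟨ cong (_+ sum deg) (*-distribˡ-sum (4 * D) (𝟙 ∘ low)) ⟨
      4 * D * #low + sum deg          ≤⟨ +-monoʳ-≤ (4 * D * #low) ∑deg≤ ⟩
      4 * D * #low + (n * D + n * D)
        ≡⟨ cong (_+ (n * D + n * D)) (solve 2 (λ d l → con 4 :* d :* l := con 2 :* l :* (con 2 :* d)) refl D #low) ⟩
      2 * #low * (2 * D) + (n * D + n * D) ∎))

-- Graphs from Boolean matrices

sum-splitAt : ∀ a {b} (h : Fin a ⊎ Fin b → ℕ) → sum (h ∘ splitAt a) ≡ sum (h ∘ inj₁) + sum (h ∘ inj₂)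
sum-splitAt a {b} h = trans (sum-++ a (h ∘ splitAt a))
  (cong₂ _+_ (sum-cong-≗ (λ i → cong h (splitAt-↑ˡ a i b)))
             (sum-cong-≗ {b} (λ j → cong h (splitAt-↑ʳ a b j))))

∣tabulate∣ : ∀ {n} (b : Fin n → Bool) → ∣ tabulate b ∣ ≡ sum (𝟙 ∘ b)
∣tabulate∣ {zero}  b = refl
∣tabulate∣ {suc n} b with b zero
... | true  = cong suc (∣tabulate∣ (b ∘ suc))
... | false = ∣tabulate∣ (b ∘ suc)

∈-tabulate⁺ : ∀ {n} (b : Fin n → Bool) {i} → b i ≡ true → i ∈ tabulate b
∈-tabulate⁺ b {i} bi = lookup⇒[]= i (tabulate b) (trans (lookup∘tabulate b i) bi)

∈-tabulate⁻ : ∀ {n} (b : Fin n → Bool) {i} → i ∈ tabulate b → b i ≡ true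
∈-tabulate⁻ b {i} i∈ = trans (sym (lookup∘tabulate b i)) ([]=⇒lookup i∈)

graphOf : ∀ {V} (A : Fin V → Fin V → Bool) → (∀ {u v} → A u v ≡ true → A v u ≡ true) →
          (∀ {u} → A u u ≢ true) → Graph V
graphOf A A-sym A-irr = record
  { nbrs      = λ u → tabulate (A u)
  ; symmetric = λ {u} {v} v∈ → ∈-tabulate⁺ (A v) (A-sym (∈-tabulate⁻ (A u) v∈))
  ; loopless  = λ {u} u∈ → A-irr (∈-tabulate⁻ (A u) u∈)
  }

-- Each pair `(x t , y t)` occurs in the list `edges H`, and its position there determines it.
edges≤size : ∀ {V k} (H : Graph V) (x y : Fin k → Fin V) → Injective _≡_ _≡_ x →
             (∀ t → x t Fin.< y t) → (∀ t → Adj H (x t) (y t)) → k ≤ size H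
edges≤size {V} {k} H x y x-inj x<y adj = injective⇒≤ {f = position} position-inj
  where
  member : ∀ t → (x t , y t) ∈ᴸ edges H
  member t = ∈-filter⁺ (λ (u , v) → (u <? v) ×-dec (v ∈? nbrs H u))
    (∈-cartesianProduct⁺ (∈-allFin (x t)) (∈-allFin (y t))) (x<y t , adj t)
  position : Fin k → Fin (size H)
  position t = index (member t)
  position-inj : Injective _≡_ _≡_ position
  position-inj {s} {t} eq = x-inj (cong proj₁
    (trans (lookup-index (member s)) (trans (cong (lookup (edges H)) eq) (sym (lookup-index (member t))))))

-- Bipartite graphs from biadjacency matrices

adj⊎ : ∀ {n} → (Fin n → Fin n → Bool) → Fin n ⊎ Fin n → Fin n ⊎ Fin n → Bool
adj⊎ E (inj₁ i) (inj₂ j) = E i j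
adj⊎ E (inj₂ j) (inj₁ i) = E i j
adj⊎ E (inj₁ _) (inj₁ _) = false
adj⊎ E (inj₂ _) (inj₂ _) = false

module Bipartite {n} (E : Fin n → Fin n → Bool) where

  lv rv : Fin n → Fin (n + n)
  lv i = i ↑ˡ n
  rv j = n ↑ʳ j

  -- Left vertices are numbered before right ones, so an edge written from left to right has the
  -- orientation that `edges` lists.
  lv<rv : ∀ i j → lv i Fin.< rv j
  lv<rv i j = subst₂ _<_ (sym (toℕ-↑ˡ i n)) (sym (toℕ-↑ʳ n j)) (≤-trans (toℕ<n i) (m≤m+n n (toℕ j)))

  A : Fin (n + n) → Fin (n + n) → Bool
  A u v = adj⊎ E (splitAt n u) (splitAt n v)

  adj⊎-sym : ∀ a b → adj⊎ E a b ≡ true → adj⊎ E b a ≡ true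
  adj⊎-sym (inj₁ _) (inj₂ _) p = p
  adj⊎-sym (inj₂ _) (inj₁ _) p = p

  adj⊎-irr : ∀ a → adj⊎ E a a ≢ true
  adj⊎-irr (inj₁ _) ()
  adj⊎-irr (inj₂ _) ()

  G : Graph (n + n)
  G = graphOf A (λ {u} {v} → adj⊎-sym (splitAt n u) (splitAt n v)) (λ {u} → adj⊎-irr (splitAt n u))

  A-lv-rv : ∀ i j → A (lv i) (rv j) ≡ E i j
  A-lv-rv i j = cong₂ (adj⊎ E) (splitAt-↑ˡ n i n) (splitAt-↑ʳ n n j)

  lv-rv⁻ : ∀ {i j} → Adj G (lv i) (rv j) → E i j ≡ true
  lv-rv⁻ {i} {j} p = trans (sym (A-lv-rv i j)) (∈-tabulate⁻ (A (lv i)) p)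

  ¬lv-lv : ∀ {i j} → ¬ Adj G (lv i) (lv j)
  ¬lv-lv {i} {j} p with trans (sym (∈-tabulate⁻ (A (lv i)) p)) (cong₂ (adj⊎ E) (splitAt-↑ˡ n i n) (splitAt-↑ˡ n j n))
  ... | ()

  ¬rv-rv : ∀ {i j} → ¬ Adj G (rv i) (rv j)
  ¬rv-rv {i} {j} p with trans (sym (∈-tabulate⁻ (A (rv i)) p)) (cong₂ (adj⊎ E) (splitAt-↑ʳ n n i) (splitAt-↑ʳ n n j))
  ... | ()

  lv-nbr : ∀ {i v} → Adj G (lv i) v → ∃[ j ] v ≡ rv j
  lv-nbr {i} {v} p with splitAt n v in eq
  ... | inj₁ j = contradiction (subst (Adj G (lv i)) (sym (splitAt⁻¹-↑ˡ eq)) p) ¬lv-lv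
  ... | inj₂ j = j , sym (splitAt⁻¹-↑ʳ eq)

  regular : ∀ {d} → (∀ i → sum (λ j → 𝟙 (E i j)) ≡ d) → (∀ j → sum (λ i → 𝟙 (E i j)) ≡ d) → Regular d G
  regular {d} rows cols u = trans (∣tabulate∣ (A u))
    (trans (sum-splitAt n (𝟙 ∘ adj⊎ E (splitAt n u))) (degree⊎ (splitAt n u)))
    where
    zeros : sum {n} (λ _ → 0) ≡ 0
    zeros = trans (sum-const n 0) (*-zeroʳ n)
    degree⊎ : ∀ a → sum (λ i → 𝟙 (adj⊎ E a (inj₁ i))) + sum (λ j → 𝟙 (adj⊎ E a (inj₂ j))) ≡ d
    degree⊎ (inj₁ i) = cong₂ _+_ zeros (rows i)
    degree⊎ (inj₂ j) = trans (cong₂ _+_ (cols j) zeros) (+-identityʳ d)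

  isLeft : Fin n ⊎ Fin n → Bool
  isLeft = [ const true , const false ]′

  bipartition : Bipartition G n
  bipartition = record
    { left      = tabulate L
    ; ∣left∣≡n  = trans (∣tabulate∣ L) (trans (sum-splitAt n (𝟙 ∘ isLeft)) (trans (cong₂ _+_ ones zeros) (+-identityʳ n)))
    ; ∣right∣≡n = trans (cong ∣_∣ (sym (tabulate-∘ not L)))
        (trans (∣tabulate∣ (not ∘ L)) (trans (sum-splitAt n (𝟙 ∘ not ∘ isLeft)) (cong₂ _+_ zeros ones)))
    ; crossing  = λ {u} {v} p → crossing⊎ (∈-tabulate⁻ (A u) p)
    }
    where
    L : Fin (n + n) → Bool
    L = isLeft ∘ splitAt n
    ones : sum {n} (λ _ → 1) ≡ n
    ones = trans (sum-const n 1) (*-identityʳ n)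
    zeros : sum {n} (λ _ → 0) ≡ 0
    zeros = trans (sum-const n 0) (*-zeroʳ n)
    outside : ∀ {u} → L u ≡ false → ¬ u ∈ tabulate L
    outside Lu u∈ with trans (sym Lu) (∈-tabulate⁻ L u∈)
    ... | ()
    crossing⊎ : ∀ {u v} → A u v ≡ true →
                (u ∈ tabulate L × ¬ v ∈ tabulate L) ⊎ (¬ u ∈ tabulate L × v ∈ tabulate L)
    crossing⊎ {u} {v} p with splitAt n u in eu | splitAt n v in ev
    ... | inj₁ _ | inj₂ _ = inj₁ (∈-tabulate⁺ L (cong isLeft eu) , outside (cong isLeft ev))
    ... | inj₂ _ | inj₁ _ = inj₂ (outside (cong isLeft eu) , ∈-tabulate⁺ L (cong isLeft ev))

  -- Turns selected edges of `M` into a subgraph. Since edges of `G` only run between the sides, the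
  -- condition `ind` on row-column entries is enough for it to be induced.
  module Submatching (M : Graph (n + n)) (M-matching : IsMatching G M)
                     {k} (r c : Fin k → Fin n) (rc∈M : ∀ t → Adj M (lv (r t)) (rv (c t)))
                     (ind : ∀ s t → E (r s) (c t) ≡ true → s ≡ t) where

    open IsMatching M-matching

    IsEnd : Fin (n + n) → Fin (n + n) → Fin k → Set
    IsEnd u v t = SameEdge (u , v) (lv (r t) , rv (c t))

    isEnd? : ∀ u v → Dec (∃[ t ] IsEnd u v t)
    isEnd? u v = any? (λ t → ((u ≟ lv (r t)) ×-dec (v ≟ rv (c t))) ⊎-dec ((u ≟ rv (c t)) ×-dec (v ≟ lv (r t))))

    flip-end : ∀ {u v t} → IsEnd u v t → IsEnd v u t
    flip-end (inj₁ (p , q)) = inj₂ (q , p)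
    flip-end (inj₂ (p , q)) = inj₁ (q , p)

    in-M : ∀ {u v t} → IsEnd u v t → Adj M u v
    in-M {t = t} (inj₁ (refl , refl)) = rc∈M t
    in-M {t = t} (inj₂ (refl , refl)) = symmetric M (rc∈M t)

    B : Fin (n + n) → Fin (n + n) → Bool
    B u v = does (isEnd? u v)

    M′ : Graph (n + n)
    M′ = graphOf B
      (λ {u} {v} p → let t , e = does-true (isEnd? u v) p in dec-true (isEnd? v u) (t , flip-end e))
      (λ {u} p → let t , e = does-true (isEnd? u u) p in loopless M (in-M e))

    M′-ends : ∀ {u v} → Adj M′ u v → ∃[ t ] IsEnd u v t
    M′-ends {u} {v} p = does-true (isEnd? u v) (∈-tabulate⁻ (B u) p)

    M′⊑M : M′ ⊑ M
    M′⊑M p = in-M (proj₂ (M′-ends p))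

    M′-induced : IsInducedMatching G M′
    M′-induced = record
      { isMatching = record { subgraph = subgraph ∘ M′⊑M ; disjoint = λ p q → disjoint (M′⊑M p) (M′⊑M q) }
      ; induced    = λ p q → separated (proj₂ (M′-ends p)) (proj₂ (M′-ends q))
      }
      where
      -- Endpoints on the same side are never adjacent. On opposite sides, adjacency makes `s` and
      -- `t` equal by `ind`, hence the two edges the same.
      separated : ∀ {u v x y s t} → IsEnd u v s → IsEnd x y t → ¬ SameEdge (u , v) (x , y) → ¬ Adj G u x
      separated (inj₁ (refl , refl)) (inj₁ (refl , refl)) _ a = ¬lv-lv a
      separated (inj₂ (refl , refl)) (inj₂ (refl , refl)) _ a = ¬rv-rv a
      separated {s = s} {t} (inj₁ (refl , refl)) (inj₂ (refl , refl)) different a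
        with refl ← ind s t (lv-rv⁻ a) = different (inj₂ (refl , refl))
      separated {s = s} {t} (inj₂ (refl , refl)) (inj₁ (refl , refl)) different a
        with refl ← ind t s (lv-rv⁻ (symmetric G a)) = different (inj₂ (refl , refl))

    M′-large : Injective _≡_ _≡_ r → k ≤ size M′
    M′-large r-inj = edges≤size M′ (lv ∘ r) (rv ∘ c) (λ p → r-inj (↑ˡ-injective n _ _ p))
      (λ t → lv<rv (r t) (c t))
      (λ t → ∈-tabulate⁺ (B (lv (r t))) (dec-true (isEnd? _ _) (t , inj₁ (refl , refl))))

-- The construction and its parameters

𝟙-not : ∀ b → 𝟙 b + 𝟙 (not b) ≡ 1
𝟙-not true  = refl
𝟙-not false = refl

count≥ : ∀ m {d} → m ≤ d → sum {d} (λ z → 𝟙 (not (toℕ z <ᵇ m))) + m ≡ d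
count≥ zero    {d}     _   = trans (+-identityʳ _) (trans (sum-const d 1) (*-identityʳ d))
count≥ (suc m) {suc d} m≤d = trans (+-suc _ m) (cong suc (count≥ m (s≤s⁻¹ m≤d)))

module Construction {d m} (m≤d : m ≤ d) (F : Fin d → Fin d → Bool)
                    (F-rows : ∀ i → sum (λ y → 𝟙 (F i y)) ≡ m) where

  -- One row of `J`: the ones are the `d - m` columns numbered from `m` on.
  filler : Fin d → Bool
  filler z = not (toℕ z <ᵇ m)

  W : Fin d → Fin (d + d) → Bool
  W i b = [ F i , filler ]′ (splitAt d b)

  E : Fin (d + d) → Fin (d + d) → Bool
  E a b = [ (λ i → W i b) , (λ i → not (W i b)) ]′ (splitAt d a)

  open Bipartite E

  W-rows : ∀ i → sum (λ b → 𝟙 (W i b)) ≡ d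
  W-rows i = trans (sum-splitAt d (λ a → 𝟙 ([ F i , filler ]′ a)))
    (trans (cong (_+ sum (𝟙 ∘ filler)) (F-rows i)) (trans (+-comm m _) (count≥ m m≤d)))

  ¬W-rows : ∀ i → sum (λ b → 𝟙 (not (W i b))) ≡ d
  ¬W-rows i = +-cancelˡ-≡ d _ _ (begin
    d + sum (λ b → 𝟙 (not (W i b)))                          ≡⟨ cong (_+ sum (λ b → 𝟙 (not (W i b)))) (W-rows i) ⟨
    sum (λ b → 𝟙 (W i b)) + sum (λ b → 𝟙 (not (W i b)))      ≡⟨ ∑-distrib-+ (λ b → 𝟙 (W i b)) (λ b → 𝟙 (not (W i b))) ⟨
    sum (λ b → 𝟙 (W i b) + 𝟙 (not (W i b)))                  ≡⟨ sum-cong-≗ (λ b → 𝟙-not (W i b)) ⟩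
    sum {d + d} (λ _ → 1)                                    ≡⟨ trans (sum-const (d + d) 1) (*-identityʳ (d + d)) ⟩
    d + d                                                    ∎)
    where open ≡-Reasoning

  E-regular : Regular d G
  E-regular = regular (λ a → rows (splitAt d a)) cols
    where
    rows : ∀ a → sum (λ b → 𝟙 ([ (λ i → W i b) , (λ i → not (W i b)) ]′ a)) ≡ d
    rows (inj₁ i) = W-rows i
    rows (inj₂ i) = ¬W-rows i
    cols : ∀ b → sum (λ a → 𝟙 (E a b)) ≡ d
    cols b = trans (sum-splitAt d (λ a → 𝟙 ([ (λ i → W i b) , (λ i → not (W i b)) ]′ a)))
      (trans (sym (∑-distrib-+ (λ i → 𝟙 (W i b)) (λ i → 𝟙 (not (W i b)))))
        (trans (sum-cong-≗ {d} (λ i → 𝟙-not (W i b))) (trans (sum-const d 1) (*-identityʳ d))))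

  E-upper : ∀ i b → E (i ↑ˡ d) b ≡ W i b
  E-upper i b = cong [ (λ i → W i b) , (λ i → not (W i b)) ]′ (splitAt-↑ˡ d i d)

  W-left : ∀ i y → W i (y ↑ˡ d) ≡ F i y
  W-left i y = cong [ F i , filler ]′ (splitAt-↑ˡ d y d)

  -- The diagonal condition holds for matching edges. It places every `c s` in a nonzero column of
  -- `F`, which matters once `F` is padded with zero columns.
  Sparse≤ : ℕ → Set
  Sparse≤ D = ∀ (r c : Fin m → Fin d) → Injective _≡_ _≡_ r → Injective _≡_ _≡_ c →
    (∀ s → F (r s) (c s) ≡ true) → sum (λ s → sum (λ t → 𝟙 (F (r s) (c t)))) ≤ m * D

  module _ (M : Graph (d + d + (d + d))) (perfect : IsPerfectMatching G M) where

    open IsPerfectMatching perfect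
    open IsMatching isMatching

    top : Fin d → Fin (d + d + (d + d))
    top i = lv (i ↑ˡ d)

    partner : ∀ i → ∃[ b ] Adj M (top i) (rv b)
    partner i = let v , p = covers (top i)
                    b , v≡ = lv-nbr (subgraph p)
                in  b , subst (Adj M (top i)) v≡ p

    mate : Fin d → Fin (d + d)
    mate i = proj₁ (partner i)

    mate-inj : Injective _≡_ _≡_ mate
    mate-inj {i} {j} eq = ↑ˡ-injective d i j (↑ˡ-injective (d + d) _ _
      (disjoint (symmetric M (proj₂ (partner i)))
                (symmetric M (subst (λ b → Adj M (top j) (rv b)) (sym eq) (proj₂ (partner j))))))

    W-mate : ∀ i → W i (mate i) ≡ true
    W-mate i = trans (sym (E-upper i (mate i))) (lv-rv⁻ (subgraph (proj₂ (partner i))))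

    inF : Fin (d + d) → Bool
    inF b = [ const true , const false ]′ (splitAt d b)

    inF⁻ : ∀ b → inF b ≡ true → ∃[ y ] b ≡ y ↑ˡ d
    inF⁻ b p with splitAt d b in eq
    ... | inj₁ y = y , sym (splitAt⁻¹-↑ˡ eq)

    -- Distinct rows have distinct mates, and a mate outside `F` is one of the `d - m` columns of
    -- ones; so at most `d - m` of the `d` upper rows are matched outside `F`.
    m≤inF : m ≤ sum (λ i → 𝟙 (inF (mate i)))
    m≤inF = +-cancelˡ-≤ (sum (𝟙 ∘ filler)) _ _ (begin
      sum (𝟙 ∘ filler) + m             ≡⟨ count≥ m m≤d ⟩
      d                                ≡⟨ *-identityʳ d ⟨
      d * 1                            ≡⟨ sum-const d 1 ⟨
      sum {d} (λ _ → 1)                ≤⟨ sum-mono one≤ ⟩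
      sum (λ i → h (mate i) + 𝟙 (inF (mate i)))
        ≡⟨ ∑-distrib-+ (h ∘ mate) (λ i → 𝟙 (inF (mate i))) ⟩
      sum (h ∘ mate) + sum (λ i → 𝟙 (inF (mate i)))
        ≤⟨ +-monoˡ-≤ _ h≤ ⟩
      sum (𝟙 ∘ filler) + sum (λ i → 𝟙 (inF (mate i))) ∎)
      where
      open ≤-Reasoning
      h⊎ : Fin d ⊎ Fin d → ℕ
      h⊎ = [ const 0 , 𝟙 ∘ filler ]′
      h : Fin (d + d) → ℕ
      h b = h⊎ (splitAt d b)
      one≤ : ∀ i → 1 ≤ h (mate i) + 𝟙 (inF (mate i))
      one≤ i with splitAt d (mate i) | W-mate i
      ... | inj₁ _ | _ = ≤-refl
      ... | inj₂ z | p = ≤-trans (≤-reflexive (cong 𝟙 (sym p))) (m≤m+n (𝟙 (filler z)) 0)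
      h≤ : sum (h ∘ mate) ≤ sum (𝟙 ∘ filler)
      h≤ = begin
        sum (h ∘ mate)                       ≤⟨ sum-injective mate mate-inj h ⟩
        sum (λ b → 𝟙 (image mate b) * h b)   ≤⟨ sum-mono (λ b → *-monoˡ-≤ (h b) (𝟙≤1 (image mate b))) ⟩
        sum (λ b → 1 * h b)                  ≡⟨ sum-cong-≗ (λ b → *-identityˡ (h b)) ⟩
        sum h                                ≡⟨ sum-splitAt d h⊎ ⟩
        sum {d} (λ _ → 0) + sum (𝟙 ∘ filler) ≡⟨ cong (_+ sum (𝟙 ∘ filler)) (trans (sum-const d 0) (*-zeroʳ d)) ⟩
        sum (𝟙 ∘ filler)                     ∎

    -- Among `m` matching edges inside `F`, sparsity bounds the number of conflicts, and an
    -- independent set of the conflict graph is an induced matching.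
    induced-in-perfect : ∀ {D} .{{_ : NonZero D}} → Sparse≤ D →
      Σ[ H ∈ Graph (d + d + (d + d)) ] (H ⊑ M × IsInducedMatching G H × m ≤ 2 * (size H * (4 * D)))
    induced-in-perfect {D} sp with choose (inF ∘ mate) m m≤inF
    ... | r , r-inj , r-inF = large (turán D (sp r c r-inj c-inj F-diag))
      where
      c : Fin m → Fin d
      c s = proj₁ (inF⁻ (mate (r s)) (r-inF s))
      mate-r : ∀ s → mate (r s) ≡ c s ↑ˡ d
      mate-r s = proj₂ (inF⁻ (mate (r s)) (r-inF s))
      c-inj : Injective _≡_ _≡_ c
      c-inj {s} {t} eq = r-inj (mate-inj (trans (mate-r s) (trans (cong (_↑ˡ d) eq) (sym (mate-r t)))))
      F-diag : ∀ s → F (r s) (c s) ≡ true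
      F-diag s = trans (sym (W-left (r s) (c s))) (trans (cong (W (r s)) (sym (mate-r s))) (W-mate (r s)))
      open Independent (λ s t → F (r s) (c t)) F-diag
      large : Σ[ k ∈ ℕ ] Σ[ ι ∈ (Fin k → Fin m) ] (IsIndependent ι × m ≤ 2 * (k * (4 * D))) →
        Σ[ H ∈ Graph (d + d + (d + d)) ] (H ⊑ M × IsInducedMatching G H × m ≤ 2 * (size H * (4 * D)))
      large (k , ι , ind , m≤) =
        S.M′ , S.M′⊑M , S.M′-induced ,
        ≤-trans m≤ (*-monoʳ-≤ 2 (*-monoˡ-≤ (4 * D) (S.M′-large r′-inj)))
        where
        r′ c′ : Fin k → Fin (d + d)
        r′ t = r (ι t) ↑ˡ d
        c′ t = c (ι t) ↑ˡ d
        rc∈M : ∀ t → Adj M (lv (r′ t)) (rv (c′ t))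
        rc∈M t = subst (λ b → Adj M (lv (r′ t)) (rv b)) (mate-r (ι t)) (proj₂ (partner (r (ι t))))
        ind′ : ∀ s t → E (r′ s) (c′ t) ≡ true → s ≡ t
        ind′ s t p = ind s t (trans (sym (trans (E-upper _ (c′ t)) (W-left _ (c (ι t))))) p)
        r′-inj : Injective _≡_ _≡_ r′
        -- Equal rows give `ι s ≡ ι t`; the diagonal entry of `F` is then an entry between `s` and
        -- `t`, and independence yields `s ≡ t`.
        r′-inj {s} {t} p = ind s t (subst (λ x → F (r (ι s)) (c x) ≡ true)
          (r-inj (↑ˡ-injective d _ _ p)) (F-diag (ι s)))
        module S = Submatching M isMatching r′ c′ rc∈M ind′

-- `size-bound` asks for a denominator whose square is at least 51200, and `256 * 256` is 65536.
c₀ : ℚ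
c₀ = (ℤ.+ 1) ℚ./ 256

Conclusion : ℕ → Set
Conclusion d = Σ[ n ∈ ℕ ] Σ[ V ∈ ℕ ] Σ[ G ∈ Graph V ]
      (0 < n × Regular d G × Bipartition G n ×
       (∀ M → IsPerfectMatching G M →
         Σ[ M′ ∈ Graph V ]
           (M′ ⊑ M × IsInducedMatching G M′ × AtLeast c₀ n d (size M′))))

-- 51200 = 4 · 8 · 40², from (2 d)² = 4 d², d ≤ 8 L h² and h ≤ 40 s.
size-bound : ∀ Q {L h d s} .{{_ : NonZero L}} → 51200 ≤ Q * Q → 2 ^ L ≤ d → d ≤ 8 * (L * (h * h)) →
  L * h ≤ 2 * (s * (4 * (3 * L + 2))) → 2 ^ ((1 * (d + d)) ^ 2) ≤ d ^ ((Q * s) ^ 2 * d)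
size-bound Q {L} {h} {d} {s} Q² 2^L≤d d≤ Lh≤ = begin
  2 ^ ((1 * (d + d)) ^ 2)          ≤⟨ ^-monoʳ-≤ 2 exponent≤ ⟩
  -- Here `L` stands in for `log₂ d`: the factor `L` in the exponent moves into the base, and
  -- `2 ^ L` is at most `d`.
  2 ^ (L * ((Q * s) ^ 2 * d))      ≡⟨ ^-*-assoc 2 L _ ⟨
  (2 ^ L) ^ ((Q * s) ^ 2 * d)      ≤⟨ ^-monoˡ-≤ ((Q * s) ^ 2 * d) 2^L≤d ⟩
  d ^ ((Q * s) ^ 2 * d)            ∎
  where
  open ≤-Reasoning
  h≤ : h ≤ 40 * s
  h≤ = *-cancelˡ-≤ L (begin
    L * h                                ≤⟨ Lh≤ ⟩
    -- As `L` is at least 1, `3 * L + 2` is at most `5 * L`, and `2 * 4 * 5` gives the 40.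
    2 * (s * (4 * (3 * L + 2)))          ≤⟨ *-monoʳ-≤ 2 (*-monoʳ-≤ s (*-monoʳ-≤ 4 (+-monoʳ-≤ (3 * L) (*-monoʳ-≤ 2 (>-nonZero⁻¹ L))))) ⟩
    2 * (s * (4 * (3 * L + 2 * L)))      ≡⟨ solve 2 (λ s l → con 2 :* (s :* (con 4 :* (con 3 :* l :+ con 2 :* l))) := l :* (con 40 :* s)) refl s L ⟩
    L * (40 * s)                         ∎)
  exponent≤ : (1 * (d + d)) ^ 2 ≤ L * ((Q * s) ^ 2 * d)
  exponent≤ = begin
    (1 * (d + d)) ^ 2                    ≡⟨ solve 1 (λ d → con 1 :* (d :+ d) :* (con 1 :* (d :+ d) :* con 1) := con 4 :* d :* d) refl d ⟩
    4 * d * d                            ≤⟨ *-monoʳ-≤ (4 * d) (≤-trans d≤ (*-monoʳ-≤ 8 (*-monoʳ-≤ L (*-mono-≤ h≤ h≤)))) ⟩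
    4 * d * (8 * (L * (40 * s * (40 * s))))
      ≡⟨ solve 3 (λ d l s → con 4 :* d :* (con 8 :* (l :* (con 40 :* s :* (con 40 :* s)))) := con 51200 :* (l :* (s :* s :* d))) refl d L s ⟩
    51200 * (L * (s * s * d))            ≤⟨ *-monoˡ-≤ (L * (s * s * d)) Q² ⟩
    Q * Q * (L * (s * s * d))
      ≡⟨ solve 4 (λ q l s d → q :* q :* (l :* (s :* s :* d)) := l :* (q :* s :* (q :* s :* con 1) :* d)) refl Q L s d ⟩
    L * ((Q * s) ^ 2 * d)                ∎

-- Padding and choice of parameters

module _ {d m q r : ℕ} where

  -- The `r` zero columns will fill the `m * q` block columns up to `d`.
  padded : (Fin d → Fin m → Fin q) → Fin d → Fin (m * q + r) → Bool
  padded f i y = [ blockGraph f i , const false ]′ (splitAt (m * q) y)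

  padded-rows : ∀ f i → sum (λ y → 𝟙 (padded f i y)) ≡ m
  padded-rows f i = begin
    sum (λ y → 𝟙 (padded f i y))                          ≡⟨ sum-splitAt (m * q) (λ a → 𝟙 ([ blockGraph f i , const false ]′ a)) ⟩
    sum (λ y → 𝟙 (blockGraph f i y)) + sum {r} (λ _ → 0)           ≡⟨ cong₂ _+_ (sum-combine m _) (trans (sum-const r 0) (*-zeroʳ r)) ⟩
    sum {m} (λ j → sum {q} (λ x → 𝟙 (blockGraph f i (combine j x)))) + 0 ≡⟨ +-identityʳ _ ⟩
    sum {m} (λ j → sum {q} (λ x → 𝟙 (blockGraph f i (combine j x))))
      ≡⟨ sum-cong-≗ {m} (λ j → trans (sum-cong-≗ {q} (λ x → cong 𝟙 (blockGraph-combine f i j x))) (sum-≟ (f i j))) ⟩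
    sum {m} (λ _ → 1)                                     ≡⟨ trans (sum-const m 1) (*-identityʳ m) ⟩
    m                                                     ∎
    where open ≡-Reasoning

  padded-true : ∀ f i y → padded f i y ≡ true → ∃[ y′ ] y ≡ y′ ↑ˡ r
  padded-true f i y p with splitAt (m * q) y in eq
  ... | inj₁ y′ = y′ , sym (splitAt⁻¹-↑ˡ eq)

  padded-↑ˡ : ∀ f i y → padded f i (y ↑ˡ r) ≡ blockGraph f i y
  padded-↑ˡ f i y = cong [ blockGraph f i , const false ]′ (splitAt-↑ˡ (m * q) y r)

-- Writing `d` as the number of block columns plus a remainder makes the padded matrix square by
-- definition.
construction : ∀ L h r .{{_ : NonZero L}} .{{_ : NonZero h}} → let d = L * h * (2 * h) + r in
  2 ^ L ≤ d → d ≤ 2 ^ suc L → d ≤ 8 * (L * (h * h)) → Conclusion d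
construction L h r 2^L≤d d≤2^ d≤ =
  d + d , d + d + (d + d) , Bipartite.G E , ≤-trans 0<d (m≤m+n d d) , E-regular , Bipartite.bipartition E ,
  λ M perfect → let H , H⊑M , ind , m≤ = induced-in-perfect M perfect {{D≢0}} sp in
    H , H⊑M , ind , size-bound 256 {L} {h} {d} {size H} (≤ᵇ⇒≤ 51200 65536 tt) 2^L≤d d≤ m≤
  where
  d = L * h * (2 * h) + r
  open Sparse L h d
  0<d : 0 < d
  0<d = ≤-trans (m^n>0 2 L) 2^L≤d
  D≢0 : NonZero (3 * L + 2)
  D≢0 = subst NonZero (+-comm 2 (3 * L)) _
  choice = sparse (m≤m+n (m * q) r) d≤2^
  f = proj₁ choice
  open Construction {d} {m} (≤-trans (m≤m*n m q) (m≤m+n (m * q) r)) (padded f) (padded-rows f)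
  sp : Sparse≤ (3 * L + 2)
  sp rr c rr-inj c-inj diag = ≤-trans (≤-reflexive
      (sum-cong-≗ {m} (λ s → sum-cong-≗ {m} (λ t → cong 𝟙 (trans (cong (padded f (rr s)) (c≡ t)) (padded-↑ˡ f (rr s) (c′ t)))))))
    (proj₂ choice rr c′ rr-inj (λ {s} {t} eq → c-inj (trans (c≡ s) (trans (cong (_↑ˡ r) eq) (sym (c≡ t))))))
    where
    c′ : Fin m → Fin (m * q)
    c′ t = proj₁ (padded-true f (rr t) (c t) (diag t))
    c≡ : ∀ t → c t ≡ c′ t ↑ˡ r
    c≡ t = proj₂ (padded-true f (rr t) (c t) (diag t))

-- Searches downwards from a failing `b`. It supplies `L` as the floor of `log₂ d`, and then the
-- largest `h` whose block columns fit into `d`.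
threshold : ∀ {P : ℕ → Set} → Decidable P → P 0 → ∀ b → ¬ P b → ∃[ n ] (P n × ¬ P (suc n))
threshold P? P0 zero    ¬Pb = contradiction P0 ¬Pb
threshold P? P0 (suc b) ¬Pb with P? b
... | yes Pb  = b , Pb , ¬Pb
... | no ¬Pb′ = threshold P? P0 b ¬Pb′

n<2^n : ∀ n → n < 2 ^ n
n<2^n zero    = s≤s z≤n
n<2^n (suc n) = ≤-trans (+-mono-≤ (m^n>0 2 n) (n<2^n n)) (≤-reflexive (cong (2 ^ n +_) (sym (+-identityʳ (2 ^ n)))))

conclusion : ∀ d → 2 ≤ d → Conclusion d
conclusion d 2≤d
  with threshold {λ L → 2 ^ L ≤ d} (λ L → 2 ^ L ≤? d) (≤-trans (s≤s z≤n) 2≤d) d (<⇒≱ (n<2^n d))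
... | zero  , _ , ¬2≤d = contradiction 2≤d ¬2≤d
... | L@(suc L′) , 2^L≤d , 2^1+L≰d
  with threshold {λ h → L * h * (2 * h) ≤ d} (λ h → L * h * (2 * h) ≤? d)
         (≤-trans (≤-reflexive (*-zeroʳ (L * 0))) z≤n) (suc d) 
         (<⇒≱ (≤-trans (m≤n*m (suc d) L) (m≤m*n (L * suc d) (2 * suc d))))
-- `h` is positive: `L ≤ 2 ^ L′` gives `2 * L ≤ 2 ^ L ≤ d`.
... | zero , _ , ¬1 = contradiction
        (≤-trans (≤-reflexive (trans (cong (_* 2) (*-identityʳ L)) (*-comm L 2)))
          (≤-trans (*-monoʳ-≤ 2 (n<2^n L′)) 2^L≤d)) ¬1
... | h@(suc h′) , Lh≤d , ¬Lh = subst Conclusion (m+[n∸m]≡n Lh≤d)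
        (construction L h (d ∸ L * h * (2 * h)) (subst (2 ^ L ≤_) (sym d≡) 2^L≤d)
          (subst (_≤ 2 ^ suc L) (sym d≡) (≰⇒≥ 2^1+L≰d)) (subst (_≤ 8 * (L * (h * h))) (sym d≡) d≤))
  where
  d≡ = m+[n∸m]≡n Lh≤d
  open ≤-Reasoning
  -- Since `h` is positive, passing from `h` to `h + 1` costs at most a factor 4 in the square,
  -- which turns the 2 of `2 * h` into 8.
  1+h≤2h : suc h ≤ 2 * h
  1+h≤2h = s≤s (≤-trans (≤-reflexive (cong suc (sym (+-identityʳ h′)))) (m≤n+m _ h′))
  d≤ : d ≤ 8 * (L * (h * h))
  d≤ = begin
    d                                ≤⟨ ≰⇒≥ ¬Lh ⟩
    L * suc h * (2 * suc h)          ≤⟨ *-mono-≤ (*-monoʳ-≤ L 1+h≤2h) (*-monoʳ-≤ 2 1+h≤2h) ⟩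
    L * (2 * h) * (2 * (2 * h))      ≡⟨ solve 2 (λ l h → l :* (con 2 :* h) :* (con 2 :* (con 2 :* h)) := con 8 :* (l :* (h :* h))) refl L h ⟩
    8 * (L * (h * h))                ∎

theorem4p7 : Σ[ c ∈ ℚ ] (Positive c × (Σ[ d₀ ∈ ℕ ] (∀ d → d₀ ≤ d →
    Σ[ n ∈ ℕ ] Σ[ V ∈ ℕ ] Σ[ G ∈ Graph V ]
    (0 < n × Regular d G × Bipartition G n ×
    (∀ M → IsPerfectMatching G M →
    Σ[ M′ ∈ Graph V ]
    (M′ ⊑ M × IsInducedMatching G M′ × AtLeast c n d (size M′)))))))
theorem4p7 = c₀ , _ , 2 , conclusion
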